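{- The minimum number of monochromatic triangles in a line $2$-coloring of the Pappus configuration, taken over all line $2$-colorings, is $0$.
   Context: A configuration is a pair $(\mathcal{P},\mathcal{L})$ with $\mathcal{P}$ a finite set of points and $\mathcal{L}$ a finite set of subsets of $\mathcal{P}$ called lines, such that any two distinct points lie together on at most one line, all points are on the same number of lines, all lines contain the same number of points, and there are at least three points. Three points $p_1,p_2,p_3$ form a triangle if there are lines $l_1,l_2,l_3$ with $p_1,p_2\in l_1$, $p_3\notin l_1$; $p_2,p_3\in l_2$, $p_1\notin l_2$; $p_1,p_3\in l_3$, $p_2\notin l_3$. The lines $l_1,l_2,l_3$ are then uniquely determined by the points. A line $2$-coloring assigns to each line one of the colors red, blue. A triangle is monochromatic if its lines $l_1,l_2,l_3$ all have the same color. The Pappus configuration is the $9_3$ configuration with points $A,B,C,a,b,c,X,Y,Z$ and lines $\{A,B,C\}$, $\{a,b,c\}$, $\{X,Y,Z\}$, $\{A,b,X\}$, $\{a,B,X\}$, $\{A,c,Y\}$, $\{a,C,Y\}$, $\{B,c,Z\}$, $\{b,C,Z\}$. -}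

module Defs where

open import Data.Nat using (ℕ; _≤_; _≤?_)
import Data.Bool as Bool
import Data.Nat.Properties as ℕ
open import Data.Fin using (Fin; #_)
open import Data.Fin.Properties using (any?; all?; _<?_; _≟_)
open import Data.Fin.Subset using (Subset; _∈_; _∉_; _∪_; ⁅_⁆; ∣_∣)
open import Data.Fin.Subset.Properties using (_∈?_)
open import Data.List using (List; length; filter; cartesianProduct; allFin)
open import Data.Product using (_×_; _,_; ∃-syntax)
open import Data.Vec using (Vec; []; _∷_; lookup)
open import Data.Vec.Properties using (≡-dec)
open import Function.Definitions using (Injective)
open import Relation.Binary using (DecidableEquality)
open import Relation.Binary.PropositionalEquality using (_≡_; _≢_; refl)
open import Relation.Nullary using (Dec; yes; no; ¬?)
open import Relation.Nullary.Decidable using (_×-dec_; _→-dec_; from-yes)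

-- The set of points is Fin points.  The set of lines is given by an injective
-- enumeration, so that Fin lines stands for the set of lines.
record Configuration : Set where
  field
    points : ℕ
    lines  : ℕ
    line   : Fin lines → Subset points

  Point : Set
  Point = Fin points

  Line : Set
  Line = Fin lines

  _on_ : Point → Line → Set
  p on l = p ∈ line l

  _off_ : Point → Line → Set
  p off l = p ∉ line l

  _on?_ : ∀ p l → Dec (p on l)
  p on? l = p ∈? line l

  pointDegree : Point → ℕ
  pointDegree p = length (filter (p on?_) (allFin lines))

  field
    line-injective : Injective _≡_ _≡_ line
    atMostOneLine  : ∀ p q → p ≢ q → ∀ l m →
                     p on l → q on l → p on m → q on m → l ≡ m
    point-regular  : ∀ p q → pointDegree p ≡ pointDegree q
    line-regular   : ∀ l m → ∣ line l ∣ ≡ ∣ line m ∣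
    points≥3       : 3 ≤ points

data Colour : Set where
  red blue : Colour

_≟ᶜ_ : DecidableEquality Colour
red  ≟ᶜ red  = yes refl
red  ≟ᶜ blue = no λ ()
blue ≟ᶜ red  = no λ ()
blue ≟ᶜ blue = yes refl

module _ (𝒞 : Configuration) where
  open Configuration 𝒞

  LineColouring : Set
  LineColouring = Line → Colour

  TriangleLines : (p₁ p₂ p₃ : Point) (l₁ l₂ l₃ : Line) → Set
  TriangleLines p₁ p₂ p₃ l₁ l₂ l₃ =
    (p₁ on l₁ × p₂ on l₁ × p₃ off l₁) ×
    (p₂ on l₂ × p₃ on l₂ × p₁ off l₂) ×
    (p₁ on l₃ × p₃ on l₃ × p₂ off l₃)

  Triangle : Point → Point → Point → Set
  Triangle p₁ p₂ p₃ = ∃[ l₁ ] ∃[ l₂ ] ∃[ l₃ ] TriangleLines p₁ p₂ p₃ l₁ l₂ l₃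

  triangleLines-unique : ∀ {p₁ p₂ p₃ l₁ l₂ l₃ m₁ m₂ m₃} →
    TriangleLines p₁ p₂ p₃ l₁ l₂ l₃ → TriangleLines p₁ p₂ p₃ m₁ m₂ m₃ →
    l₁ ≡ m₁ × l₂ ≡ m₂ × l₃ ≡ m₃
  triangleLines-unique
    ((p₁l₁ , p₂l₁ , p₃∉l₁) , (p₂l₂ , p₃l₂ , p₁∉l₂) , (p₁l₃ , p₃l₃ , _))
    ((p₁m₁ , p₂m₁ , _) , (p₂m₂ , p₃m₂ , _) , (p₁m₃ , p₃m₃ , _)) =
      atMostOneLine _ _ (λ { refl → p₁∉l₂ p₂l₂ }) _ _ p₁l₁ p₂l₁ p₁m₁ p₂m₁
    , atMostOneLine _ _ (λ { refl → p₃∉l₁ p₂l₁ }) _ _ p₂l₂ p₃l₂ p₂m₂ p₃m₂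
    , atMostOneLine _ _ (λ { refl → p₁∉l₂ p₃l₂ }) _ _ p₁l₃ p₃l₃ p₁m₃ p₃m₃

  -- By triangleLines-unique, the existential quantifiers pick out the lines of
  -- the triangle p₁ p₂ p₃.
  MonochromaticTriangle : LineColouring → Point → Point → Point → Set
  MonochromaticTriangle χ p₁ p₂ p₃ =
    ∃[ l₁ ] ∃[ l₂ ] ∃[ l₃ ]
      TriangleLines p₁ p₂ p₃ l₁ l₂ l₃ × χ l₁ ≡ χ l₂ × χ l₂ ≡ χ l₃

  triangleLines? : ∀ p₁ p₂ p₃ l₁ l₂ l₃ → Dec (TriangleLines p₁ p₂ p₃ l₁ l₂ l₃)
  triangleLines? p₁ p₂ p₃ l₁ l₂ l₃ =
    ((p₁ on? l₁) ×-dec (p₂ on? l₁) ×-dec ¬? (p₃ on? l₁)) ×-dec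
    ((p₂ on? l₂) ×-dec (p₃ on? l₂) ×-dec ¬? (p₁ on? l₂)) ×-dec
    ((p₁ on? l₃) ×-dec (p₃ on? l₃) ×-dec ¬? (p₂ on? l₃))

  monochromaticTriangle? : ∀ χ p₁ p₂ p₃ → Dec (MonochromaticTriangle χ p₁ p₂ p₃)
  monochromaticTriangle? χ p₁ p₂ p₃ =
    any? λ l₁ → any? λ l₂ → any? λ l₃ →
      triangleLines? p₁ p₂ p₃ l₁ l₂ l₃ ×-dec (χ l₁ ≟ᶜ χ l₂) ×-dec (χ l₂ ≟ᶜ χ l₃)

  -- Being a monochromatic triangle does not depend on the order of the three
  -- (necessarily distinct) points, so each triangle is listed exactly once, with
  -- its points in increasing order.
  monochromaticTriangles : LineColouring → List (Point × Point × Point)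
  monochromaticTriangles χ =
    filter (λ (p₁ , p₂ , p₃) →
             (p₁ <? p₂) ×-dec (p₂ <? p₃) ×-dec monochromaticTriangle? χ p₁ p₂ p₃)
      (cartesianProduct (allFin points)
        (cartesianProduct (allFin points) (allFin points)))

  #monochromaticTriangles : LineColouring → ℕ
  #monochromaticTriangles χ = length (monochromaticTriangles χ)

IsMinimumOf : ∀ {a} {X : Set a} → ℕ → (X → ℕ) → Set a
IsMinimumOf m f = (∃[ x ] f x ≡ m) × (∀ x → m ≤ f x)

private
  A B C a b c X Y Z : Fin 9
  A = # 0
  B = # 1
  C = # 2
  a = # 3
  b = # 4
  c = # 5
  X = # 6
  Y = # 7
  Z = # 8

  ⟨_,_,_⟩ : Fin 9 → Fin 9 → Fin 9 → Subset 9
  ⟨ p , q , r ⟩ = ⁅ p ⁆ ∪ ⁅ q ⁆ ∪ ⁅ r ⁆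

pappusLines : Vec (Subset 9) 9
pappusLines = ⟨ A , B , C ⟩
            ∷ ⟨ a , b , c ⟩
            ∷ ⟨ X , Y , Z ⟩
            ∷ ⟨ A , b , X ⟩
            ∷ ⟨ a , B , X ⟩
            ∷ ⟨ A , c , Y ⟩
            ∷ ⟨ a , C , Y ⟩
            ∷ ⟨ B , c , Z ⟩
            ∷ ⟨ b , C , Z ⟩
            ∷ []

private
  _≟ˢ_ : DecidableEquality (Subset 9)
  _≟ˢ_ = ≡-dec Bool._≟_

  pl : Fin 9 → Subset 9
  pl = lookup pappusLines

  injective : ∀ l m → pl l ≡ pl m → l ≡ m
  injective = from-yes (all? λ l → all? λ m → (pl l ≟ˢ pl m) →-dec (l ≟ m))

  linear : ∀ p q → p ≢ q → ∀ l m →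
           p ∈ pl l → q ∈ pl l → p ∈ pl m → q ∈ pl m → l ≡ m
  linear = from-yes (all? λ p → all? λ q → ¬? (p ≟ q) →-dec
    (all? λ l → all? λ m → (p ∈? pl l) →-dec ((q ∈? pl l) →-dec
      ((p ∈? pl m) →-dec ((q ∈? pl m) →-dec (l ≟ m))))))

  degree : Fin 9 → ℕ
  degree p = length (filter (λ l → p ∈? pl l) (allFin 9))

  regularᵖ : ∀ p q → degree p ≡ degree q
  regularᵖ = from-yes (all? λ p → all? λ q → degree p ℕ.≟ degree q)

  regularˡ : ∀ l m → ∣ pl l ∣ ≡ ∣ pl m ∣
  regularˡ = from-yes (all? λ l → all? λ m → ∣ pl l ∣ ℕ.≟ ∣ pl m ∣)

pappus : Configuration
pappus = record
  { points         = 9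
  ; lines          = 9
  ; line           = lookup pappusLines
  ; line-injective = λ {l} {m} → injective l m
  ; atMostOneLine  = linear
  ; point-regular  = regularᵖ
  ; line-regular   = regularˡ
  ; points≥3       = from-yes (3 ≤? 9)
  }

{-# OPTIONS --safe #-}

-- The nine lines split into the three parallel classes {ABC, abc, XYZ},
-- {AbX, aCY, BcZ} and {aBX, AcY, bCZ}.  The lines of a triangle meet pairwise,
-- so they come from three different classes; colouring one class red and the
-- other two blue therefore leaves no triangle monochromatic.
module Submission where

open import Defs
open import Data.Fin using (zero; suc)
open import Data.Nat using (z≤n)
open import Data.Product using (_,_)
open import Relation.Binary.PropositionalEquality using (refl)

-- In `pappusLines` the class ABC, abc, XYZ occupies indices 0, 1, 2, while the other two classes
-- are interleaved as 3, 6, 7 and 4, 5, 8. Making the first class the red one lets a single pattern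
-- cover all blue lines.
firstClassRed : LineColouring pappus
firstClassRed zero                = red
firstClassRed (suc zero)          = red
firstClassRed (suc (suc zero))    = red
firstClassRed (suc (suc (suc _))) = blue

theorem4p5 : IsMinimumOf 0 (#monochromaticTriangles pappus)
-- `refl` decides the count by evaluation: the filter over all 729 triples of points reduces to the
-- empty list, so the parallel classes need no formal counterpart.
theorem4p5 = (firstClassRed , refl) , λ _ → z≤n
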